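{- Let $T_4=\{(x,y)\in\mathbb{N}^2\mid x+y\le 5\}$. Then $\mathrm{gon}(R(T_4))=6$.
   Context: $\mathbb{N}=\{1,2,3,\dots\}$. For a finite set $F\subset\mathbb{N}^2$, the Ferrers rook graph $R(F)$ is the simple graph with vertex set $F$ in which distinct $(x,y),(x',y')$ are adjacent iff $x=x'$ or $y=y'$. Chip firing: firing a vertex sends one chip to each neighbor; divisors are equivalent if related by firings. An effective divisor $D$ has positive rank if for every vertex $v$ there is an effective divisor equivalent to $D$ with a positive number of chips at $v$. The gonality $\mathrm{gon}(G)$ is the minimum degree of an effective divisor of positive rank on $G$. -}

module Defs where

open import Data.Nat as ℕ using (ℕ; zero; suc)
open import Data.Integer as ℤ using (ℤ; +_; _-_; _*_; _≤_; _<_)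
open import Data.Fin using (Fin; zero; suc)
open import Data.List using (List; []; _∷_; length; lookup; filter; concatMap; map)
open import Data.List.Base using (upTo)
open import Data.Product using (_×_; _,_; ∃; Σ)
open import Data.Bool using (Bool; true; false; if_then_else_; _∧_; _∨_; not)
open import Relation.Nullary.Decidable using (⌊_⌋; Dec)
open import Relation.Binary.PropositionalEquality using (_≡_; refl)

-- A finite simple graph on vertex set Fin n, given by a (symmetric, irreflexive) adjacency test.
record Graph : Set where
  field
    n   : ℕ
    adj : Fin n → Fin n → Bool
open Graph public

sumFin : ∀ n → (Fin n → ℤ) → ℤ
sumFin zero    f = + 0
sumFin (suc n) f = f zero ℤ.+ sumFin n (λ i → f (suc i))

Divisor : Graph → Set
Divisor G = Fin (n G) → ℤ

deg : (G : Graph) → Divisor G → ℤ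
deg G D = sumFin (n G) D

Effective : (G : Graph) → Divisor G → Set
Effective G D = ∀ v → + 0 ≤ D v

a : (G : Graph) → Fin (n G) → Fin (n G) → ℤ
a G v w = if adj G v w then + 1 else + 0

-- Applying a firing script f (vertex v fires f v times; negative = borrowing):
-- each firing of v sends one chip to each neighbour of v.
fire : (G : Graph) → (Fin (n G) → ℤ) → Divisor G → Divisor G
fire G f D v = D v - sumFin (n G) (λ w → a G v w * (f v - f w))

-- D ~ D' iff D' is obtained from D by a sequence of firings (and their inverses),
-- i.e. by an integer firing script.
Equiv : (G : Graph) → Divisor G → Divisor G → Set
Equiv G D D' = ∃ λ (f : Fin (n G) → ℤ) → ∀ v → D' v ≡ fire G f D v

PositiveRank : (G : Graph) → Divisor G → Set
PositiveRank G D =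
  ∀ v → ∃ λ (E : Divisor G) → Effective G E × Equiv G D E × + 0 < E v

Gonality : Graph → ℕ → Set
Gonality G k =
  (∃ λ (D : Divisor G) → Effective G D × PositiveRank G D × deg G D ≡ + k)
  × (∀ (D : Divisor G) → Effective G D → PositiveRank G D → + k ≤ deg G D)

-- Ferrers rook graph of a finite set F ⊂ ℕ², given as a duplicate-free list of points.
Point : Set
Point = ℕ × ℕ

R : List Point → Graph
R F = record { n = length F ; adj = λ i j → adjP (lookup F i) (lookup F j) }
  where
  adjP : Point → Point → Bool
  adjP (x , y) (x' , y') =
    not (⌊ x ℕ.≟ x' ⌋ ∧ ⌊ y ℕ.≟ y' ⌋) ∧ (⌊ x ℕ.≟ x' ⌋ ∨ ⌊ y ℕ.≟ y' ⌋)

-- T₄ = {(x,y) ∈ ℕ² | x + y ≤ 5}, ℕ = {1,2,3,...}; listed without duplicates.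
range : ℕ → List ℕ
range k = map suc (upTo k)

inT4 : Point → Set
inT4 (x , y) = x ℕ.+ y ℕ.≤ 5

inT4? : (p : Point) → Dec (inT4 p)
inT4? (x , y) = x ℕ.+ y ℕ.≤? 5

T4 : List Point
T4 = filter inT4? (concatMap (λ x → map (λ y → (x , y)) (range 5)) (range 5))

_ : length T4 ≡ 10
_ = refl

{-# OPTIONS --safe #-}
-- Upper bound: one chip on every vertex with x ≥ 2.  Firing all those vertices moves the chips to
-- 3, 2, 1, 0 on the line x = 1, and then firing everything except (1,4) puts chips on (1,4).
--
-- Lower bound: burn the graph from a vertex v, vertex u catching fire at time h u.  If D has no chip
-- at v and fewer chips at each other u than u has neighbours burning before it, then (Dhar) no
-- effective divisor equivalent to D has a chip at v: for an effective fire f D with a chip at v,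
-- induction on h shows that no vertex can attain the maximum of f.  This condition is inherited by
-- smaller divisors, and may be tested after a preliminary firing g; so each choice of v, h, g yields
-- a ceiling below which no divisor has positive rank.  Sixty ceilings suffice to dominate every
-- effective divisor of degree at most 5.
module Submission where

open import Defs

open import Data.Bool using (true; false; if_then_else_)
open import Data.Bool.Properties using (T-≡)
open import Data.Fin using (Fin; zero; suc; #_)
import Data.Fin.Properties as Fin
open import Data.Integer as ℤ using (ℤ; +_; _+_; -_; _-_; _*_; _≤_; _<_; +≤+)
import Data.Integer.Properties as ℤ
open import Data.Integer.Tactic.RingSolver using (solve-∀)
open import Data.List using (List; []; _∷_; allFin)
import Data.List.Extrema ℤ.≤-totalOrder as Extrema
open import Data.List.Membership.Propositional.Properties using (∈-allFin)
open import Data.List.Relation.Unary.All as All using (All)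
open import Data.List.Relation.Unary.Any as Any using (Any)
open import Data.Nat as ℕ using (ℕ; zero; suc; z≤n; s≤s)
open import Data.Nat.Induction using (<-rec)
import Data.Nat.Properties as ℕ
open import Data.Product using (_×_; _,_; ∃; proj₁; proj₂)
open import Data.Vec as Vec using (Vec; []; _∷_; lookup)
import Data.Vec.Properties as Vec
open import Data.Vec.Relation.Binary.Pointwise.Inductive as Pointwise using (Pointwise)
open import Function using (_∘_; case_of_)
open import Function.Bundles using (module Equivalence)
open import Relation.Binary.PropositionalEquality
open import Relation.Nullary using (¬_; Dec; yes; no)
open import Relation.Nullary.Decidable using (_×-dec_; ⌊_⌋; map′; from-yes)
open import Relation.Unary using (Decidable)

-- Finite sums and maxima over `Fin n`.

sumFin-cong : ∀ n {f g : Fin n → ℤ} → (∀ i → f i ≡ g i) → sumFin n f ≡ sumFin n g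
sumFin-cong zero    f≗g = refl
sumFin-cong (suc n) f≗g = cong₂ _+_ (f≗g zero) (sumFin-cong n (f≗g ∘ suc))

sumFin-mono-≤ : ∀ n {f g : Fin n → ℤ} → (∀ i → f i ≤ g i) → sumFin n f ≤ sumFin n g
sumFin-mono-≤ zero    f≤g = ℤ.≤-refl
sumFin-mono-≤ (suc n) f≤g = ℤ.+-mono-≤ (f≤g zero) (sumFin-mono-≤ n (f≤g ∘ suc))

sumFin-0≤ : ∀ n {f : Fin n → ℤ} → (∀ i → + 0 ≤ f i) → + 0 ≤ sumFin n f
sumFin-0≤ zero    0≤f = ℤ.≤-refl
sumFin-0≤ (suc n) 0≤f = ℤ.+-mono-≤ (0≤f zero) (sumFin-0≤ n (0≤f ∘ suc))

sumFin-+ : ∀ n (f g : Fin n → ℤ) → sumFin n (λ i → f i + g i) ≡ sumFin n f + sumFin n g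
sumFin-+ zero    f g = refl
sumFin-+ (suc n) f g = begin
  f zero + g zero + sumFin n (λ i → f (suc i) + g (suc i))
    ≡⟨ cong (λ s → f zero + g zero + s) (sumFin-+ n (f ∘ suc) (g ∘ suc)) ⟩
  f zero + g zero + (sumFin n (f ∘ suc) + sumFin n (g ∘ suc))
    ≡⟨ interchange (f zero) (g zero) _ _ ⟩
  f zero + sumFin n (f ∘ suc) + (g zero + sumFin n (g ∘ suc)) ∎
  where
  open ≡-Reasoning
  interchange : ∀ w x y z → w + x + (y + z) ≡ w + y + (x + z)
  interchange = solve-∀

sumFin-lookup : ∀ {n} (ds : Vec ℕ n) → sumFin n (λ i → + lookup ds i) ≡ + Vec.sum ds
sumFin-lookup []       = refl
sumFin-lookup (d ∷ ds) = cong (λ s → + d + s) (sumFin-lookup ds)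

maximum : ∀ {n} → Fin n → (f : Fin n → ℤ) → ∃ λ m → ∀ i → f i ≤ f m
maximum {n} i₀ f =
  Extrema.argmax f i₀ (allFin n) ,
  λ i → All.lookup (Extrema.f[xs]≤f[argmax] {f = f} i₀ (allFin n)) (∈-allFin i)

-- Firing scripts and Dhar's burning argument on an arbitrary graph.

module _ (G : Graph) where

  private
    V : Set
    V = Fin (n G)

  -- The graph Laplacian applied to `f`: the net number of chips that `v` loses.
  outflow : (V → ℤ) → V → ℤ
  outflow f v = sumFin (n G) λ w → a G v w * (f v - f w)

  0≤a* : ∀ v w {x} → + 0 ≤ x → + 0 ≤ a G v w * x
  0≤a* v w {x} 0≤x with adj G v w
  ... | true  = subst (+ 0 ≤_) (sym (ℤ.*-identityˡ x)) 0≤x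
  ... | false = ℤ.≤-refl

  a≤a* : ∀ v w {x} → + 1 ≤ x → a G v w ≤ a G v w * x
  a≤a* v w {x} 1≤x with adj G v w
  ... | true  = subst (+ 1 ≤_) (sym (ℤ.*-identityˡ x)) 1≤x
  ... | false = ℤ.≤-refl

  fire-mono-≤ : ∀ f {D D′} → (∀ v → D v ≤ D′ v) → ∀ v → fire G f D v ≤ fire G f D′ v
  fire-mono-≤ f D≤D′ v = ℤ.+-monoˡ-≤ (- outflow f v) (D≤D′ v)

  fire-fire : ∀ f g D v → fire G (λ w → f w - g w) (fire G g D) v ≡ fire G f D v
  fire-fire f g D v = begin
    D v - outflow g v - outflow (λ w → f w - g w) v
      ≡⟨ regroup (D v) (outflow g v) _ ⟩
    D v - (outflow g v + outflow (λ w → f w - g w) v)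
      ≡⟨ cong (λ s → D v - s) (sumFin-+ (n G) _ _) ⟨
    D v - sumFin (n G) (λ w → a G v w * (g v - g w) + a G v w * (f v - g v - (f w - g w)))
      ≡⟨ cong (λ s → D v - s) (sumFin-cong (n G) λ w → telescope (a G v w) (f v) (f w) (g v) (g w)) ⟩
    D v - outflow f v ∎
    where
    open ≡-Reasoning
    regroup : ∀ x y z → x - y - z ≡ x - (y + z)
    regroup = solve-∀
    telescope : ∀ e fv fw gv gw → e * (gv - gw) + e * (fv - gv - (fw - gw)) ≡ e * (fv - fw)
    telescope = solve-∀

  -- Counts the neighbours of `u` that burn strictly before it; neighbours burning at the same time
  -- do not count.
  inflow : (V → ℕ) → V → ℤ
  inflow h u = sumFin (n G) λ w → if h w ℕ.<ᵇ h u then a G u w else + 0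

  -- Dhar's condition as a pointwise upper bound. The `- + 1` turns "fewer chips than burnt
  -- neighbours" into a weak inequality; a vertex with no earlier neighbour must therefore be in
  -- debt.
  cap : V → (V → ℕ) → Divisor G
  cap v h u = if ⌊ u Fin.≟ v ⌋ then + 0 else inflow h u - + 1

  dhar : ∀ v h D → (∀ u → D u ≤ cap v h u) →
         ∀ f → Effective G (fire G f D) → ¬ (+ 0 < fire G f D v)
  -- At the maximiser `m` itself, `below-max` gives `f m < f m`.
  dhar v h D D≤cap f eff 0<Ev = ℤ.<-irrefl refl (below-max (h m) m refl)
    where
    m = proj₁ (maximum v f)

    ≤-max : ∀ w → f w ≤ f m
    ≤-max = proj₂ (maximum v f)

    fire-≤ : ∀ u {x y} → D u ≤ x → y ≤ outflow f u → fire G f D u ≤ x - y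
    fire-≤ u D≤x y≤out = ℤ.+-mono-≤ D≤x (ℤ.neg-mono-≤ y≤out)

    0≤f-f : ∀ u → f u ≡ f m → ∀ w → + 0 ≤ f u - f w
    0≤f-f u fu≡fm w = ℤ.i≤j⇒0≤j-i (subst (f w ≤_) (sym fu≡fm) (≤-max w))

    0≤outflow : ∀ u → f u ≡ f m → + 0 ≤ outflow f u
    0≤outflow u fu≡fm = sumFin-0≤ (n G) λ w → 0≤a* u w (0≤f-f u fu≡fm w)

    -- Scripts are integral, so each neighbour strictly below the maximum takes at least one chip
    -- from `u`, and no neighbour sends any back.
    inflow≤outflow : ∀ u → f u ≡ f m → (∀ w → h w ℕ.< h u → f w < f m) → inflow h u ≤ outflow f u
    inflow≤outflow u fu≡fm earlier = sumFin-mono-≤ (n G) term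
      where
      term : ∀ w → (if h w ℕ.<ᵇ h u then a G u w else + 0) ≤ a G u w * (f u - f w)
      term w with h w ℕ.<ᵇ h u in eq
      ... | false = 0≤a* u w (0≤f-f u fu≡fm w)
      ... | true  = a≤a* u w (subst (_≤ f u - f w) (cancel (f w))
                                    (ℤ.+-monoˡ-≤ (- f w) (ℤ.i<j⇒suc[i]≤j fw<fu)))
        where
        fw<fu : f w < f u
        fw<fu = subst (f w <_) (sym fu≡fm) (earlier w (ℕ.<ᵇ⇒< _ _ (Equivalence.from T-≡ eq)))
        cancel : ∀ x → + 1 + x - x ≡ + 1
        cancel = solve-∀

    -- A maximiser gains no chips. The source would thus end with at most 0, contradicting `0<Ev`;
    -- any other vertex would pay out at least `inflow h u` from at most `inflow h u - + 1` and end
    -- in debt.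
    not-max : ∀ u → (∀ w → h w ℕ.< h u → f w < f m) → f u ≢ f m
    not-max u earlier fu≡fm with u Fin.≟ v | D≤cap u
    ... | yes refl | D≤0 = ℤ.<⇒≱ 0<Ev (fire-≤ u D≤0 (0≤outflow u fu≡fm))
    ... | no _     | D<inflow = case eff-absurd of λ ()
      where
      cancel : ∀ x → x - + 1 - x ≡ - + 1
      cancel = solve-∀
      eff-absurd : + 0 ≤ - + 1
      eff-absurd = subst (+ 0 ≤_) (cancel (inflow h u))
        (ℤ.≤-trans (eff u) (fire-≤ u D<inflow (inflow≤outflow u fu≡fm earlier)))

    below-max : ∀ k u → h u ≡ k → f u < f m
    -- Strong induction on burning time: everything burning before `u` is already below the maximum.
    below-max = <-rec _ λ k rec u hu≡k →
      ℤ.≤∧≢⇒< (≤-max u) (not-max u λ w hw<hu → rec (subst (h w ℕ.<_) hu≡k hw<hu) w refl)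

  -- Decidable certificates against positive rank.

  effective? : Decidable (Effective G)
  effective? D = Fin.all? λ v → + 0 ℤ.≤? D v

  -- `time` is the burning order from `source`, and `script` the preliminary firing. Natural entries
  -- suffice for `script`, since adding a constant to a script does not change its effect.
  record Certificate : Set where
    constructor cert
    field
      ceiling : Vec ℕ (n G)
      source  : V
      time    : Vec ℕ (n G)
      script  : Vec ℕ (n G)

  open Certificate

  Valid : Certificate → Set
  Valid c = ∀ u → fire G (λ w → + lookup (script c) w) (λ w → + lookup (ceiling c) w) u
                ≤ cap (source c) (lookup (time c)) u

  valid? : Decidable Valid
  valid? c = Fin.all? λ u → _ ℤ.≤? _

  -- Firing `g` preserves the pointwise order, so validity at the ceiling also bounds `fire G g D`.
  -- A script `f` from `D` to `E` becomes `f - g` when started from `fire G g D`, and `dhar` applies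
  -- there.
  ceiling-¬PositiveRank : ∀ {c D} → Valid c → (∀ u → D u ≤ + lookup (ceiling c) u) → ¬ PositiveRank G D
  ceiling-¬PositiveRank {c} {D} valid D≤c rank with rank (source c)
  ... | E , eff , (f , E≗fire) , 0<Ev =
    dhar (source c) (lookup (time c)) (fire G g D)
      (λ u → ℤ.≤-trans (fire-mono-≤ g D≤c u) (valid u))
      (λ w → f w - g w)
      (λ u → subst (+ 0 ≤_) (E≗ u) (eff u))
      (subst (+ 0 <_) (E≗ (source c)) 0<Ev)
    where
    g = λ w → + lookup (script c) w
    E≗ : ∀ u → E u ≡ fire G (λ w → f w - g w) (fire G g D) u
    E≗ u = trans (E≗fire u) (sym (fire-fire f g D u))

-- Exhaustive search over vectors of bounded sum.

∀sum≤? : ∀ {p} n k {P : Vec ℕ n → Set p} → Decidable P → Dec (∀ ds → Vec.sum ds ℕ.≤ k → P ds)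
∀sum≤? zero    k P? = map′ (λ { p [] _ → p }) (λ p → p [] z≤n) (P? [])
∀sum≤? (suc n) k {P} P? = map′ to from
  -- The first entry `d` ranges over 0 to `k`, leaving `k ∸ d` for the tail; `allUpTo?` has a strict
  -- bound, hence `suc k`.
  (ℕ.allUpTo? (λ d → ∀sum≤? n (k ℕ.∸ d) (λ ds → P? (d ∷ ds))) (suc k))
  where
  to : (∀ {d} → d ℕ.< suc k → ∀ ds → Vec.sum ds ℕ.≤ k ℕ.∸ d → P (d ∷ ds)) → ∀ ds → Vec.sum ds ℕ.≤ k → P ds
  to p (d ∷ ds) sum≤k =
    p (s≤s (ℕ.m+n≤o⇒m≤o d sum≤k)) ds (ℕ.m+n≤o⇒m≤o∸n (Vec.sum ds) (subst (ℕ._≤ k) (ℕ.+-comm d _) sum≤k))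
  from : (∀ ds → Vec.sum ds ℕ.≤ k → P ds) → ∀ {d} → d ℕ.< suc k → ∀ ds → Vec.sum ds ℕ.≤ k ℕ.∸ d → P (d ∷ ds)
  from p {d} (s≤s d≤k) ds sum≤ =
    p (d ∷ ds) (ℕ.≤-trans (ℕ.+-monoʳ-≤ d sum≤) (ℕ.≤-reflexive (ℕ.m+[n∸m]≡n d≤k)))

-- Lower bound: explicit ceilings for `T4`.

_≤ᵛ_ : ∀ {n} → Vec ℕ n → Vec ℕ n → Set
_≤ᵛ_ = Pointwise ℕ._≤_

-- The arguments follow the order of the list `T4`, so the subscripts are the coordinates of the
-- vertex.
tri : (x₁₁ x₁₂ x₁₃ x₁₄ x₂₁ x₂₂ x₂₃ x₃₁ x₃₂ x₄₁ : ℕ) → Vec ℕ 10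
tri x₁₁ x₁₂ x₁₃ x₁₄ x₂₁ x₂₂ x₂₃ x₃₁ x₃₂ x₄₁ =
  x₁₁ ∷ x₁₂ ∷ x₁₃ ∷ x₁₄ ∷ x₂₁ ∷ x₂₂ ∷ x₂₃ ∷ x₃₁ ∷ x₃₂ ∷ x₄₁ ∷ []

-- Found by a computer search (greedy set cover over random burning orders).
certificates : List (Certificate (R T4))
certificates =
  cert (tri 0 2 1 0 1 2 2 1 0 2) (# 0) (tri 0 3 2 1 6 7 8 5 4 7) (tri 0 0 0 0 0 0 0 0 0 0)
  ∷ cert (tri 0 0 1 2 2 0 2 1 1 2) (# 1) (tri 1 0 2 3 4 1 5 3 2 5) (tri 0 0 0 0 0 0 0 0 0 0)
  ∷ cert (tri 1 0 0 2 3 1 1 1 0 2) (# 1) (tri 2 0 1 3 4 2 3 3 1 5) (tri 0 0 0 0 0 0 0 0 0 0)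
  ∷ cert (tri 1 0 2 0 2 1 0 1 2 2) (# 1) (tri 2 0 3 1 6 5 4 7 8 8) (tri 0 0 0 0 0 0 0 0 0 0)
  ∷ cert (tri 3 0 1 0 1 0 1 3 1 1) (# 1) (tri 5 0 2 1 4 1 3 7 2 6) (tri 0 0 0 0 0 0 0 0 0 0)
  ∷ cert (tri 0 2 0 1 1 2 0 2 2 1) (# 2) (tri 1 3 0 2 2 4 1 4 5 3) (tri 0 0 0 0 0 0 0 0 0 0)
  ∷ cert (tri 4 2 0 0 0 1 0 1 1 2) (# 2) (tri 7 4 0 1 2 3 1 6 5 8) (tri 0 0 0 0 0 0 0 0 0 0)
  ∷ cert (tri 0 1 3 0 3 0 1 1 1 1) (# 3) (tri 1 2 9 0 7 3 8 5 4 6) (tri 0 0 0 0 0 0 0 0 0 0)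
  ∷ cert (tri 1 4 0 0 0 1 1 3 0 1) (# 3) (tri 2 7 1 0 3 5 4 7 6 4) (tri 0 0 0 0 0 0 0 0 0 0)
  ∷ cert (tri 2 0 1 0 3 1 2 2 0 0) (# 3) (tri 3 1 2 0 6 3 7 5 2 4) (tri 0 0 0 0 0 0 0 0 0 0)
  ∷ cert (tri 2 1 0 0 2 1 2 0 2 1) (# 3) (tri 3 2 1 0 6 7 8 4 8 5) (tri 0 0 0 0 0 0 0 0 0 0)
  ∷ cert (tri 1 1 0 2 0 1 2 2 2 0) (# 4) (tri 2 4 3 5 0 5 6 3 6 1) (tri 0 0 0 0 0 0 0 0 0 0)
  ∷ cert (tri 1 2 3 1 0 1 0 0 1 2) (# 6) (tri 3 4 6 5 1 2 0 2 3 4) (tri 0 0 0 0 0 0 0 0 0 0)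
  ∷ cert (tri 3 1 2 2 0 1 0 1 0 1) (# 6) (tri 6 4 7 8 1 2 0 4 3 5) (tri 0 0 0 0 0 0 0 0 0 0)
  ∷ cert (tri 2 0 1 2 0 2 1 0 2 1) (# 7) (tri 3 4 5 6 1 7 6 0 8 2) (tri 0 0 0 0 0 0 0 0 0 0)
  ∷ cert (tri 2 2 2 2 1 0 1 0 1 0) (# 7) (tri 3 5 6 7 2 3 4 0 4 1) (tri 0 0 0 0 0 0 0 0 0 0)
  ∷ cert (tri 4 1 3 0 1 2 0 0 0 0) (# 7) (tri 7 5 8 6 2 4 3 0 1 1) (tri 0 0 0 0 0 0 0 0 0 0)
  ∷ cert (tri 2 1 0 1 2 0 1 2 0 2) (# 8) (tri 5 2 3 4 6 1 4 7 0 8) (tri 0 0 0 0 0 0 0 0 0 0)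
  ∷ cert (tri 4 0 0 1 2 3 1 0 0 0) (# 8) (tri 4 1 2 3 5 7 6 1 0 2) (tri 0 0 0 0 0 0 0 0 0 0)
  ∷ cert (tri 0 3 1 2 2 1 0 1 1 0) (# 9) (tri 1 7 5 8 3 5 4 2 6 0) (tri 0 0 0 0 0 0 0 0 0 0)
  ∷ cert (tri 1 1 2 1 0 3 1 2 0 0) (# 9) (tri 2 5 7 6 1 9 8 3 4 0) (tri 0 0 0 0 0 0 0 0 0 0)
  ∷ cert (tri 1 2 0 1 4 1 1 0 1 0) (# 9) (tri 2 5 3 4 9 7 8 1 6 0) (tri 0 0 0 0 0 0 0 0 0 0)
  ∷ cert (tri 3 5 0 1 0 0 0 0 1 1) (# 7) (tri 6 4 5 7 1 3 2 0 5 2) (tri 0 1 0 0 0 0 0 0 0 0)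
  ∷ cert (tri 0 0 4 1 4 0 0 1 0 1) (# 8) (tri 4 2 3 5 7 1 4 5 0 6) (tri 0 0 1 0 0 0 0 0 0 0)
  ∷ cert (tri 0 1 0 3 0 3 1 0 1 2) (# 4) (tri 2 5 4 3 0 7 5 1 6 3) (tri 0 0 0 1 0 0 0 0 0 0)
  ∷ cert (tri 2 0 1 5 0 1 0 1 1 0) (# 4) (tri 5 4 6 7 0 2 1 2 3 1) (tri 0 0 0 1 0 0 0 0 0 0)
  ∷ cert (tri 0 1 2 3 1 0 0 3 1 0) (# 5) (tri 4 6 7 5 2 0 1 8 7 3) (tri 0 0 0 1 0 0 0 0 0 0)
  ∷ cert (tri 1 2 1 3 1 0 2 0 0 1) (# 5) (tri 5 7 8 6 3 0 9 2 1 4) (tri 0 0 0 1 0 0 0 0 0 0)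
  ∷ cert (tri 0 1 0 4 2 2 0 0 2 0) (# 7) (tri 2 7 5 6 3 8 4 0 9 1) (tri 0 0 0 1 0 0 0 0 0 0)
  ∷ cert (tri 0 0 0 5 0 0 2 3 0 1) (# 8) (tri 3 2 4 5 2 1 5 5 0 4) (tri 0 0 0 1 0 0 0 0 0 0)
  ∷ cert (tri 0 0 0 2 5 1 1 1 0 1) (# 2) (tri 2 1 0 3 3 4 5 4 2 5) (tri 0 0 0 0 1 0 0 0 0 0)
  ∷ cert (tri 1 3 2 0 1 4 0 0 0 0) (# 9) (tri 2 7 6 3 3 4 5 1 5 0) (tri 0 0 0 0 0 1 0 0 0 0)
  ∷ cert (tri 0 0 1 1 1 1 4 1 2 0) (# 1) (tri 1 0 3 2 4 6 5 3 7 2) (tri 0 0 0 0 0 0 1 0 0 0)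
  ∷ cert (tri 0 1 1 0 2 2 3 1 1 0) (# 3) (tri 1 2 3 0 5 6 4 3 4 2) (tri 0 0 0 0 0 0 1 0 0 0)
  ∷ cert (tri 0 4 0 1 1 0 3 0 1 1) (# 7) (tri 1 7 5 6 3 5 4 0 6 2) (tri 0 0 0 0 0 0 1 0 0 0)
  ∷ cert (tri 3 1 0 2 0 0 5 0 0 0) (# 7) (tri 5 4 6 7 2 3 7 0 1 1) (tri 0 0 0 0 0 0 1 0 0 0)
  ∷ cert (tri 1 0 2 0 0 0 4 2 0 2) (# 8) (tri 3 1 6 2 4 2 5 5 0 6) (tri 0 0 0 0 0 0 1 0 0 0)
  ∷ cert (tri 1 0 2 1 1 2 3 0 0 1) (# 8) (tri 2 1 6 3 4 6 5 1 0 3) (tri 0 0 0 0 0 0 1 0 0 0)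
  ∷ cert (tri 2 2 1 0 0 2 3 0 1 0) (# 9) (tri 3 6 5 4 2 8 3 1 7 0) (tri 0 0 0 0 0 0 1 0 0 0)
  ∷ cert (tri 0 0 0 2 2 2 0 4 0 1) (# 6) (tri 3 2 1 4 7 6 0 4 5 8) (tri 0 0 0 0 0 0 0 1 0 0)
  ∷ cert (tri 1 2 0 0 2 0 0 4 1 1) (# 6) (tri 4 3 1 2 6 1 0 5 6 7) (tri 0 0 0 0 0 0 0 1 0 0)
  ∷ cert (tri 1 2 3 1 0 0 0 4 0 0) (# 6) (tri 5 6 8 7 2 1 0 3 4 4) (tri 0 0 0 0 0 0 0 1 0 0)
  ∷ cert (tri 0 0 0 2 0 0 2 0 5 2) (# 2) (tri 1 2 0 3 2 3 4 3 4 4) (tri 0 0 0 0 0 0 0 0 1 0)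
  ∷ cert (tri 0 1 1 0 1 1 0 2 4 1) (# 3) (tri 1 3 2 0 4 5 3 7 6 5) (tri 0 0 0 0 0 0 0 0 1 0)
  ∷ cert (tri 2 0 0 0 3 2 0 1 3 0) (# 3) (tri 3 2 1 0 6 7 2 5 3 4) (tri 0 0 0 0 0 0 0 0 1 0)
  ∷ cert (tri 5 0 0 1 0 0 0 0 4 1) (# 4) (tri 7 3 2 4 0 2 1 5 4 6) (tri 0 0 0 0 0 0 0 0 1 0)
  ∷ cert (tri 0 0 3 1 1 1 1 1 3 0) (# 9) (tri 1 5 8 6 2 6 7 3 4 0) (tri 0 0 0 0 0 0 0 0 1 0)
  ∷ cert (tri 1 3 1 1 0 0 1 1 3 0) (# 9) (tri 2 9 7 8 1 5 6 3 4 0) (tri 0 0 0 0 0 0 0 0 1 0)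
  ∷ cert (tri 2 0 1 2 0 1 0 0 0 5) (# 1) (tri 6 0 4 7 4 2 3 5 1 7) (tri 0 0 0 0 0 0 0 0 0 1)
  ∷ cert (tri 1 1 0 0 1 3 0 1 1 3) (# 2) (tri 3 2 0 1 5 8 1 6 7 4) (tri 0 0 0 0 0 0 0 0 0 1)
  ∷ cert (tri 4 1 0 0 0 0 1 0 2 3) (# 3) (tri 8 2 1 0 5 3 4 7 8 6) (tri 0 0 0 0 0 0 0 0 0 1)
  ∷ cert (tri 1 0 0 1 1 0 1 1 2 4) (# 5) (tri 4 1 2 3 5 0 3 7 8 6) (tri 0 0 0 0 0 0 0 0 0 1)
  ∷ cert (tri 0 4 2 0 0 0 0 0 0 5) (# 6) (tri 4 7 6 5 2 1 0 3 2 5) (tri 0 0 0 0 0 0 0 0 0 1)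
  ∷ cert (tri 1 1 1 1 2 0 0 2 0 3) (# 8) (tri 5 2 3 4 7 1 2 8 0 6) (tri 0 0 0 0 0 0 0 0 0 1)
  ∷ cert (tri 0 0 5 4 0 0 0 1 1 0) (# 4) (tri 3 4 5 6 0 1 2 2 3 1) (tri 0 0 1 1 0 0 0 0 0 0)
  ∷ cert (tri 1 1 4 0 0 1 2 0 2 0) (# 9) (tri 3 6 4 5 2 7 3 1 8 0) (tri 0 0 1 0 0 0 1 0 0 0)
  ∷ cert (tri 0 0 2 0 0 5 2 0 1 1) (# 3) (tri 1 2 6 0 4 6 5 2 7 3) (tri 0 0 0 0 0 1 1 0 0 0)
  ∷ cert (tri 0 0 0 1 0 5 0 1 3 0) (# 0) (tri 0 3 1 2 2 5 3 3 4 1) (tri 0 0 0 0 0 1 0 0 1 0)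
  ∷ cert (tri 1 0 0 0 1 0 1 5 2 1) (# 3) (tri 3 2 1 0 6 4 5 7 3 8) (tri 0 0 0 0 0 0 0 1 1 0)
  ∷ cert (tri 0 0 1 0 0 1 2 3 1 3) (# 1) (tri 3 0 2 1 6 7 8 4 8 5) (tri 0 0 0 0 0 0 0 1 0 1)
  ∷ []

certificates-valid : All (Valid (R T4)) certificates
certificates-valid = from-yes (All.all? (valid? (R T4)) certificates)

-- Settled by evaluation over the 3003 vectors of ten naturals with sum at most 5.
ceilings-cover : ∀ ds → Vec.sum ds ℕ.≤ 5 → Any (λ c → ds ≤ᵛ Certificate.ceiling c) certificates
ceilings-cover = from-yes
  (∀sum≤? 10 5 λ ds → Any.any? (λ c → Pointwise.decidable ℕ._≤?_ ds (Certificate.ceiling c)) certificates)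

small-¬PositiveRank : ∀ D → Effective (R T4) D → deg (R T4) D ≤ + 5 → ¬ PositiveRank (R T4) D
small-¬PositiveRank D eff deg≤5 = All.lookupWith (λ {c} → ¬rank {c}) certificates-valid (ceilings-cover ds sum≤5)
  where
  ds : Vec ℕ 10
  -- Taking absolute values changes nothing, because `D` is effective.
  ds = Vec.tabulate λ u → ℤ.∣ D u ∣

  ds≗D : ∀ u → + lookup ds u ≡ D u
  ds≗D u = trans (cong +_ (Vec.lookup∘tabulate (λ w → ℤ.∣ D w ∣) u)) (ℤ.0≤i⇒+∣i∣≡i (eff u))

  sum≤5 : Vec.sum ds ℕ.≤ 5
  sum≤5 = ℤ.drop‿+≤+ (subst (_≤ + 5) (trans (sumFin-cong 10 (sym ∘ ds≗D)) (sumFin-lookup ds)) deg≤5)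

  ¬rank : ∀ {c} → Valid (R T4) c → ds ≤ᵛ Certificate.ceiling c → ¬ PositiveRank (R T4) D
  ¬rank {c} valid ds≤c = ceiling-¬PositiveRank (R T4) {c} valid λ u →
    subst (_≤ + lookup (Certificate.ceiling c) u) (ds≗D u) (+≤+ (Pointwise.lookup ds≤c u))

-- Upper bound: a divisor of degree 6 with positive rank.

optimal : Divisor (R T4)
optimal u = + lookup (tri 0 0 0 0 1 1 1 1 1 1) u

optimal-PositiveRank : PositiveRank (R T4) optimal
optimal-PositiveRank v =
  moved v , proj₁ (reaches v) , (script v , λ _ → refl) , proj₂ (reaches v)
  where
  script : Fin 10 → Fin 10 → ℤ
  script v u = + lookup (lookup scripts v) u
    where
    stay toLine toCorner : Vec ℕ 10
    stay     = tri 0 0 0 0 0 0 0 0 0 0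
    toLine   = tri 0 0 0 0 1 1 1 1 1 1
    -- The sum of `toLine` and the script firing everything except (1,4) once; it leaves 2, 1, 0, 3
    -- chips on the line x = 1.
    toCorner = tri 1 1 1 0 2 2 2 2 2 2
    scripts : Vec (Vec ℕ 10) 10
    -- One script per target vertex; the last six vertices already hold a chip.
    scripts = toLine ∷ toLine ∷ toLine ∷ toCorner ∷ Vec.replicate 6 stay

  moved : Fin 10 → Divisor (R T4)
  moved v = fire (R T4) (script v) optimal

  reaches : ∀ v → Effective (R T4) (moved v) × + 0 < moved v v
  reaches = from-yes (Fin.all? λ v → effective? (R T4) (moved v) ×-dec (+ 0 ℤ.<? moved v v))

theorem4p4 : Gonality (R T4) 6
theorem4p4 =
  (optimal , (λ _ → +≤+ z≤n) , optimal-PositiveRank , refl) ,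
  λ D eff rank → ℤ.≮⇒≥ λ deg<6 → small-¬PositiveRank D eff (deg≤5 deg<6) rank
  where
  deg≤5 : ∀ {i} → i < + 6 → i ≤ + 5
  deg≤5 = ℤ.i<j⇒i≤pred[j]
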